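{- Let $\Theta$ be a decorated theory with pure subtheory $\Theta_0$, and let $\Theta_A=F_{\mathrm{exp}}\Theta$. Let $M_0$ be a model of $\Theta_0$ and $M_A$ a terminal model of $\Theta_A$ over $M_0$ (a terminal object of the category $\mathrm{Mod}(\Theta_A)|_{M_0}$). Then there is a bijection $$M_A(A)\;\cong\;\mathrm{Mod}(\Theta)|_{M_0}$$ which maps each $\alpha\in M_A(A)$ to the model $M_{A,\alpha}$ of $\Theta$ defined by $M_{A,\alpha}(X)=M_0(X)$ for each type $X$ and $M_{A,\alpha}(f)=M_A(f')(\alpha,-)$ for each term $f$, so that $M_{A,\alpha}(f)=M_A(f)$ for each pure term $f$.
   Context: Size issues are ignored. Theories. A (equational) theory is a category with chosen finite products; its objects are called types and its morphisms terms. Morphisms of theories are functors strictly preserving the chosen finite products. $\mathrm{Set}$ is the theory of sets with cartesian products as chosen products. Models. A model of a theory $\Theta$ is a morphism of theories $M\colon\Theta\to\mathrm{Set}$; morphisms of models are natural transformations. Given a morphism of theories $\theta\colon\Theta_1\to\Theta$ and a model $M_1$ of $\Theta_1$, $\mathrm{Mod}(\Theta)|_{M_1}$ is the category of models $M$ of $\Theta$ over $M_1$, i.e. with $M\circ\theta=M_1$, and of morphisms $m$ with $m\circ\theta=\mathrm{id}_{M_1}$. Here models of $\Theta$ and of $\Theta_A$ over $M_0$ refer to the inclusion $\Theta_0\to\Theta$ and to the canonical morphism $\Theta_0\to\Theta_A$ respectively; since $\Theta_0$ is wide in $\Theta$, $\mathrm{Mod}(\Theta)|_{M_0}$ is a discrete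 category, regarded as a set. Decorated theories. A decorated theory is a theory $\Theta$ together with a wide subtheory $\Theta_0$ (a subcategory with the same types, containing all identities and chosen projections, closed under composition and tuples, with the same chosen products). Terms of $\Theta_0$ are called pure. The construction $F_{\mathrm{exp}}$. In a theory with a distinguished type $A$, the projections from $A\times X$ are $\mathrm{pr}_X\colon A\times X\to A$ and $\varepsilon_X\colon A\times X\to X$. $F_{\mathrm{exp}}\Theta$ is the theory $\Theta_A$ with distinguished type $A$ generated by: the theory $\Theta_0$ (all types and pure terms of $\Theta$, with their identities, composites, chosen products and tuples, so that there is a morphism of theories $\Theta_0\to\Theta_A$), a new type $A$, and a term $f'\colon A\times X\to Y$ for each term $f\colon X\to Y$ of $\Theta$, subject to the relations: $f'=f\circ\varepsilon_X$ if $f$ is pure; $(g\circ f)'=g'\circ\langle \mathrm{pr}_X,f'\rangle$ for $f\colon X\to Y$, $g\colon Y\to Z$; and $\langle f_1,\dots,f_n\rangle'=\langle f_1',\dots,f_n'\rangle$ for all $n\ge 0$. That is, morphisms of theories $\Theta_A\to\Theta'$ correspond bijectively to a morphism of theories $\Theta_0\to\Theta'$, a type of $\Theta'$, and a family of terms of $\Theta'$ satisfying these relations. -}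

module Defs where

open import Level using (Level; _⊔_) renaming (suc to lsuc)
open import Data.Nat.Base using (ℕ; zero; suc)
open import Data.Fin.Base using (Fin; zero; suc)
open import Data.Product.Base using (Σ; Σ-syntax; _×_; _,_; proj₁; proj₂)
open import Data.Unit.Polymorphic.Base using (⊤; tt)
open import Data.Vec.Functional using (Vector; []; _∷_)
import Function.Base as Fun
open import Relation.Binary.Bundles using (Setoid)
open import Relation.Binary.Structures using (IsEquivalence)
open import Relation.Binary.PropositionalEquality
  using (_≡_; refl; sym; trans; cong; cong₂)
import Relation.Binary.PropositionalEquality.Properties as ≡ₚ
import Relation.Binary.Reasoning.Setoid as SetoidReasoning

record Category (o ℓ e : Level) : Set (lsuc (o ⊔ ℓ ⊔ e)) where
  infix  4 _⇒_ _≈_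
  infixr 9 _∘_
  field
    Obj : Set o
    _⇒_ : Obj → Obj → Set ℓ
    _≈_ : ∀ {X Y} → X ⇒ Y → X ⇒ Y → Set e
    id  : ∀ {X} → X ⇒ X
    _∘_ : ∀ {X Y Z} → Y ⇒ Z → X ⇒ Y → X ⇒ Z

    ≈-equiv   : ∀ {X Y} → IsEquivalence (_≈_ {X} {Y})
    ∘-resp-≈  : ∀ {X Y Z} {g g′ : Y ⇒ Z} {f f′ : X ⇒ Y} →
                g ≈ g′ → f ≈ f′ → g ∘ f ≈ g′ ∘ f′
    assoc     : ∀ {W X Y Z} {h : Y ⇒ Z} {g : X ⇒ Y} {f : W ⇒ X} →
                (h ∘ g) ∘ f ≈ h ∘ (g ∘ f)
    identityˡ : ∀ {X Y} {f : X ⇒ Y} → id ∘ f ≈ f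
    identityʳ : ∀ {X Y} {f : X ⇒ Y} → f ∘ id ≈ f

  homSetoid : Obj → Obj → Setoid ℓ e
  homSetoid X Y = record { isEquivalence = ≈-equiv {X} {Y} }

  module _ {X Y : Obj} where
    open IsEquivalence (≈-equiv {X} {Y}) public using ()
      renaming (refl to ≈-refl; sym to ≈-sym; trans to ≈-trans)

  IsTerminal : Obj → Set (o ⊔ ℓ ⊔ e)
  IsTerminal T = ∀ X → Σ[ f ∈ X ⇒ T ] (∀ (g : X ⇒ T) → g ≈ f)

-- Morphisms of theories preserve products on the nose, so a theory must
-- have an equality of types.  As there are no quotients it is, like the
-- equality of terms, an equivalence relation _≈ₒ_.  A proof p of
-- X ≈ₒ Y makes terms on X and on Y comparable through `coe p`, the
-- identity term of X = Y; by coe-id and coe-∘ it does not depend on p.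

record Theory (o q ℓ e : Level) : Set (lsuc (o ⊔ q ⊔ ℓ ⊔ e)) where
  field
    category : Category o ℓ e
  open Category category public
  infix 4 _≈ₒ_
  field
    _≈ₒ_     : Obj → Obj → Set q
    ≈ₒ-equiv : IsEquivalence _≈ₒ_
    coe      : ∀ {X Y} → X ≈ₒ Y → X ⇒ Y
    coe-id   : ∀ {X} (p : X ≈ₒ X) → coe p ≈ id
    coe-∘    : ∀ {X Y Z} (p : X ≈ₒ Y) (r : Y ≈ₒ Z) (t : X ≈ₒ Z) →
               coe r ∘ coe p ≈ coe t

    prod      : ∀ {n} → Vector Obj n → Obj
    prod-cong : ∀ {n} {Xs Ys : Vector Obj n} →
                (∀ i → Xs i ≈ₒ Ys i) → prod Xs ≈ₒ prod Ys
    π         : ∀ {n} {Xs : Vector Obj n} (i : Fin n) → prod Xs ⇒ Xs i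
    π-coe     : ∀ {n} {Xs Ys : Vector Obj n} (p : ∀ i → Xs i ≈ₒ Ys i) i →
                π i ∘ coe (prod-cong p) ≈ coe (p i) ∘ π i
    tuple     : ∀ {n Z} {Xs : Vector Obj n} → (∀ i → Z ⇒ Xs i) → Z ⇒ prod Xs
    π-tuple   : ∀ {n Z} {Xs : Vector Obj n} (fs : ∀ i → Z ⇒ Xs i) i →
                π i ∘ tuple fs ≈ fs i
    tuple-unique : ∀ {n Z} {Xs : Vector Obj n}
                   (fs : ∀ i → Z ⇒ Xs i) (h : Z ⇒ prod Xs) →
                   (∀ i → π i ∘ h ≈ fs i) → h ≈ tuple fs

  open IsEquivalence ≈ₒ-equiv public using ()
    renaming (refl to ≈ₒ-refl; sym to ≈ₒ-sym; trans to ≈ₒ-trans)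

  -- Equality of terms whose domains (and codomains) are only equal in the
  -- sense of _≈ₒ_.
  infix 4 _≋_
  record _≋_ {X Y X′ Y′} (f : X ⇒ Y) (g : X′ ⇒ Y′) : Set (q ⊔ e) where
    eta-equality
    constructor mk≋
    field
      dom≈   : X ≈ₒ X′
      cod≈   : Y ≈ₒ Y′
      square : coe cod≈ ∘ f ≈ g ∘ coe dom≈

  ≈⇒≋ : ∀ {X Y} {f g : X ⇒ Y} → f ≈ g → f ≋ g
  ≈⇒≋ f≈g = mk≋ ≈ₒ-refl ≈ₒ-refl
    (≈-trans (∘-resp-≈ (coe-id _) f≈g)
      (≈-trans identityˡ
        (≈-trans (≈-sym identityʳ) (∘-resp-≈ ≈-refl (≈-sym (coe-id _))))))

  ≋-sym : ∀ {X Y X′ Y′} {f : X ⇒ Y} {g : X′ ⇒ Y′} → f ≋ g → g ≋ f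
  ≋-sym {Y = Y} {X′ = X′} {f = f} {g} (mk≋ p r s) = mk≋ (≈ₒ-sym p) (≈ₒ-sym r) (begin
    coe (≈ₒ-sym r) ∘ g                                ≈⟨ ∘-resp-≈ ≈-refl identityʳ ⟨
    coe (≈ₒ-sym r) ∘ (g ∘ id)                         ≈⟨ ∘-resp-≈ ≈-refl (∘-resp-≈ ≈-refl (coe-cancel (≈ₒ-sym p) p)) ⟨
    coe (≈ₒ-sym r) ∘ (g ∘ (coe p ∘ coe (≈ₒ-sym p)))   ≈⟨ ∘-resp-≈ ≈-refl assoc ⟨
    coe (≈ₒ-sym r) ∘ ((g ∘ coe p) ∘ coe (≈ₒ-sym p))   ≈⟨ ∘-resp-≈ ≈-refl (∘-resp-≈ s ≈-refl) ⟨
    coe (≈ₒ-sym r) ∘ ((coe r ∘ f) ∘ coe (≈ₒ-sym p))   ≈⟨ ∘-resp-≈ ≈-refl assoc ⟩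
    coe (≈ₒ-sym r) ∘ (coe r ∘ (f ∘ coe (≈ₒ-sym p)))   ≈⟨ assoc ⟨
    (coe (≈ₒ-sym r) ∘ coe r) ∘ (f ∘ coe (≈ₒ-sym p))   ≈⟨ ∘-resp-≈ (coe-cancel r (≈ₒ-sym r)) ≈-refl ⟩
    id ∘ (f ∘ coe (≈ₒ-sym p))                         ≈⟨ identityˡ ⟩
    f ∘ coe (≈ₒ-sym p)                                ∎)
    where
    open SetoidReasoning (homSetoid X′ Y)
    coe-cancel : ∀ {A B} (a : A ≈ₒ B) (b : B ≈ₒ A) → coe b ∘ coe a ≈ id
    coe-cancel a b = ≈-trans (coe-∘ a b ≈ₒ-refl) (coe-id _)

  ≋-trans : ∀ {X Y X′ Y′ X″ Y″}
            {f : X ⇒ Y} {g : X′ ⇒ Y′} {h : X″ ⇒ Y″} → f ≋ g → g ≋ h → f ≋ h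
  ≋-trans {X} {Y″ = Y″} {f = f} {g} {h} (mk≋ p r s) (mk≋ p′ r′ s′) =
    mk≋ (≈ₒ-trans p p′) (≈ₒ-trans r r′) (begin
      coe (≈ₒ-trans r r′) ∘ f   ≈⟨ ∘-resp-≈ (coe-∘ r r′ _) ≈-refl ⟨
      (coe r′ ∘ coe r) ∘ f      ≈⟨ assoc ⟩
      coe r′ ∘ (coe r ∘ f)      ≈⟨ ∘-resp-≈ ≈-refl s ⟩
      coe r′ ∘ (g ∘ coe p)      ≈⟨ assoc ⟨
      (coe r′ ∘ g) ∘ coe p      ≈⟨ ∘-resp-≈ s′ ≈-refl ⟩
      (h ∘ coe p′) ∘ coe p      ≈⟨ assoc ⟩
      h ∘ (coe p′ ∘ coe p)      ≈⟨ ∘-resp-≈ ≈-refl (coe-∘ p p′ _) ⟩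
      h ∘ coe (≈ₒ-trans p p′)   ∎)
    where open SetoidReasoning (homSetoid X Y″)

private
  variable
    o q ℓ e o′ q′ ℓ′ e′ o″ q″ ℓ″ e″ : Level

record Morphism (Θ : Theory o q ℓ e) (Θ′ : Theory o′ q′ ℓ′ e′) :
                Set (o ⊔ q ⊔ ℓ ⊔ e ⊔ o′ ⊔ q′ ⊔ ℓ′ ⊔ e′) where
  private
    module S = Theory Θ
    module T = Theory Θ′
  field
    F₀ : S.Obj → T.Obj
    F₁ : ∀ {X Y} → X S.⇒ Y → F₀ X T.⇒ F₀ Y
    F₁-resp-≈ : ∀ {X Y} {f g : X S.⇒ Y} → f S.≈ g → F₁ f T.≈ F₁ g
    F₁-id     : ∀ {X} → F₁ (S.id {X}) T.≈ T.id
    F₁-∘      : ∀ {X Y Z} {g : Y S.⇒ Z} {f : X S.⇒ Y} →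
                F₁ (g S.∘ f) T.≈ F₁ g T.∘ F₁ f
    F₀-cong   : ∀ {X Y} → X S.≈ₒ Y → F₀ X T.≈ₒ F₀ Y
    F₁-coe    : ∀ {X Y} (p : X S.≈ₒ Y) → F₁ (S.coe p) T.≈ T.coe (F₀-cong p)
    F₀-prod   : ∀ {n} (Xs : Vector S.Obj n) →
                F₀ (S.prod Xs) T.≈ₒ T.prod (λ i → F₀ (Xs i))
    F₁-π      : ∀ {n} (Xs : Vector S.Obj n) i →
                F₁ (S.π {Xs = Xs} i) T.≈ T.π i T.∘ T.coe (F₀-prod Xs)

open Morphism public using (F₀; F₁; F₀-prod)

infixr 9 _∘ᴹ_
_∘ᴹ_ : {Θ : Theory o q ℓ e} {Θ′ : Theory o′ q′ ℓ′ e′} {Θ″ : Theory o″ q″ ℓ″ e″} →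
       Morphism Θ′ Θ″ → Morphism Θ Θ′ → Morphism Θ Θ″
_∘ᴹ_ {Θ″ = Θ″} G F = record
  { F₀        = λ X → G.F₀ (F.F₀ X)
  ; F₁        = λ f → G.F₁ (F.F₁ f)
  ; F₁-resp-≈ = λ f≈g → G.F₁-resp-≈ (F.F₁-resp-≈ f≈g)
  ; F₁-id     = ≈-trans (G.F₁-resp-≈ F.F₁-id) G.F₁-id
  ; F₁-∘      = ≈-trans (G.F₁-resp-≈ F.F₁-∘) G.F₁-∘
  ; F₀-cong   = λ p → G.F₀-cong (F.F₀-cong p)
  ; F₁-coe    = λ p → ≈-trans (G.F₁-resp-≈ (F.F₁-coe p)) (G.F₁-coe _)
  ; F₀-prod   = λ Xs → ≈ₒ-trans (G.F₀-cong (F.F₀-prod Xs)) (G.F₀-prod _)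
  ; F₁-π      = λ Xs i →
      ≈-trans (G.F₁-resp-≈ (F.F₁-π Xs i))
      (≈-trans G.F₁-∘
      (≈-trans (∘-resp-≈ (G.F₁-π _ i) (G.F₁-coe _))
      (≈-trans assoc (∘-resp-≈ ≈-refl (coe-∘ _ _ _)))))
  }
  where
  module F = Morphism F
  module G = Morphism G
  open Theory Θ″

infix 4 _≗_
record _≗_ {Θ : Theory o q ℓ e} {Θ′ : Theory o′ q′ ℓ′ e′}
           (F G : Morphism Θ Θ′) : Set (o ⊔ q ⊔ ℓ ⊔ e ⊔ o′ ⊔ q′ ⊔ ℓ′ ⊔ e′) where
  private
    module S = Theory Θ
    module T = Theory Θ′
  field
    eq₀ : ∀ X → F₀ F X T.≈ₒ F₀ G X
    eq₁ : ∀ {X Y} (f : X S.⇒ Y) → F₁ F f T.≋ F₁ G f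

open _≗_ public

morphismSetoid : Theory o q ℓ e → Theory o′ q′ ℓ′ e′ → Setoid _ _
morphismSetoid Θ Θ′ = record
  { Carrier       = Morphism Θ Θ′
  ; _≈_           = _≗_
  ; isEquivalence = record
    { refl  = record { eq₀ = λ _ → ≈ₒ-refl ; eq₁ = λ _ → ≈⇒≋ ≈-refl }
    ; sym   = λ h → record
      { eq₀ = λ X → ≈ₒ-sym (eq₀ h X) ; eq₁ = λ f → ≋-sym (eq₁ h f) }
    ; trans = λ h k → record
      { eq₀ = λ X → ≈ₒ-trans (eq₀ h X) (eq₀ k X)
      ; eq₁ = λ f → ≋-trans (eq₁ h f) (eq₁ k f) }
    }
  }
  where open Theory Θ′

module _ {s : Level} where

  -- X₁ × (X₂ × … × (Xₙ × ⊤)); the function type (i : Fin n) → Xs i would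
  -- not have unique tuples without function extensionality.
  ∏ : ∀ {n} → Vector (Set s) n → Set s
  ∏ {zero}  Xs = ⊤
  ∏ {suc n} Xs = Xs zero × ∏ (λ i → Xs (suc i))

  ∏-cong : ∀ {n} {Xs Ys : Vector (Set s) n} → (∀ i → Xs i ≡ Ys i) → ∏ Xs ≡ ∏ Ys
  ∏-cong {zero}  p = refl
  ∏-cong {suc n} p = cong₂ _×_ (p zero) (∏-cong (λ i → p (suc i)))

  ∏-π : ∀ {n} {Xs : Vector (Set s) n} (i : Fin n) → ∏ Xs → Xs i
  ∏-π zero    (x , _)  = x
  ∏-π (suc i) (_ , xs) = ∏-π i xs

  ∏-tuple : ∀ {n} {Z : Set s} {Xs : Vector (Set s) n} →
            (∀ i → Z → Xs i) → Z → ∏ Xs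
  ∏-tuple {zero}  fs z = tt
  ∏-tuple {suc n} fs z = fs zero z , ∏-tuple (λ i → fs (suc i)) z

  transport : {X Y : Set s} → X ≡ Y → X → Y
  transport refl x = x

  private
    transport-cong₂-× : {X X′ Y Y′ : Set s} (p : X ≡ X′) (r : Y ≡ Y′) {x : X} {y : Y} →
      transport (cong₂ _×_ p r) (x , y) ≡ (transport p x , transport r y)
    transport-cong₂-× refl refl = refl

    ∏-π-transport : ∀ {n} {Xs Ys : Vector (Set s) n} (p : ∀ i → Xs i ≡ Ys i) i xs →
      ∏-π {Xs = Ys} i (transport (∏-cong p) xs) ≡ transport (p i) (∏-π {Xs = Xs} i xs)
    ∏-π-transport p zero    (x , xs) =
      cong proj₁ (transport-cong₂-× (p zero) (∏-cong (λ i → p (suc i))))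
    ∏-π-transport {Ys = Ys} p (suc i) (x , xs) = trans
      (cong (λ t → ∏-π {Xs = λ j → Ys (suc j)} i (proj₂ t))
        (transport-cong₂-× (p zero) (∏-cong (λ j → p (suc j)))))
      (∏-π-transport (λ j → p (suc j)) i xs)

    ∏-π-tuple : ∀ {n Z} {Xs : Vector (Set s) n} (fs : ∀ i → Z → Xs i) i z →
      ∏-π {Xs = Xs} i (∏-tuple fs z) ≡ fs i z
    ∏-π-tuple fs zero    z = refl
    ∏-π-tuple fs (suc i) z = ∏-π-tuple (λ j → fs (suc j)) i z

    ∏-tuple-unique : ∀ {n Z} {Xs : Vector (Set s) n} (fs : ∀ i → Z → Xs i) (h : Z → ∏ Xs) →
      (∀ i z → ∏-π {Xs = Xs} i (h z) ≡ fs i z) → ∀ z → h z ≡ ∏-tuple fs z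
    ∏-tuple-unique {zero}  fs h p z = refl
    ∏-tuple-unique {suc n} fs h p z = cong₂ _,_ (p zero z)
      (∏-tuple-unique (λ i → fs (suc i)) (λ z′ → proj₂ (h z′)) (λ i → p (suc i)) z)

    transport-id : {X : Set s} (p : X ≡ X) → ∀ x → transport p x ≡ x
    transport-id refl x = refl

    transport-∘ : {X Y Z : Set s} (p : X ≡ Y) (r : Y ≡ Z) (t : X ≡ Z) →
                  ∀ x → transport r (transport p x) ≡ transport t x
    transport-∘ refl refl refl x = refl

  SetCategory : Category (lsuc s) s s
  SetCategory = record
    { Obj       = Set s
    ; _⇒_       = λ X Y → X → Y
    ; _≈_       = λ f g → ∀ x → f x ≡ g x
    ; id        = Fun.id
    ; _∘_       = λ g f x → g (f x)
    ; ≈-equiv   = record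
      { refl  = λ _ → refl
      ; sym   = λ p x → sym (p x)
      ; trans = λ p r x → trans (p x) (r x) }
    ; ∘-resp-≈  = λ {_} {_} {_} {g} {g′} {f} {f′} p r x → trans (cong g (r x)) (p (f′ x))
    ; assoc     = λ _ → refl
    ; identityˡ = λ _ → refl
    ; identityʳ = λ _ → refl
    }

  SetTheory : Theory (lsuc s) (lsuc s) s s
  SetTheory = record
    { category     = SetCategory
    ; _≈ₒ_         = _≡_
    ; ≈ₒ-equiv     = ≡ₚ.isEquivalence
    ; coe          = transport
    ; coe-id       = transport-id
    ; coe-∘        = transport-∘
    ; prod         = ∏
    ; prod-cong    = ∏-cong
    ; π            = λ {_} {Xs} → ∏-π {Xs = Xs}
    ; π-coe        = ∏-π-transport
    ; tuple        = ∏-tuple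
    ; π-tuple      = ∏-π-tuple
    ; tuple-unique = ∏-tuple-unique
    }

Model : (s : Level) → Theory o q ℓ e → Set _
Model s Θ = Morphism Θ (SetTheory {s})

module _ {s : Level} {Θ₁ : Theory o′ q′ ℓ′ e′} {Θ : Theory o q ℓ e}
         (θ : Morphism Θ₁ Θ) (M₁ : Model s Θ₁) where

  private
    module Θ₁ = Theory Θ₁
    module Θ  = Theory Θ

  record ModelOver : Set (o ⊔ q ⊔ ℓ ⊔ e ⊔ o′ ⊔ q′ ⊔ ℓ′ ⊔ e′ ⊔ lsuc s) where
    field
      model : Model s Θ
      over  : model ∘ᴹ θ ≗ M₁

  open ModelOver

  -- In restrict, m ∘ θ = id: M ∘ θ and N ∘ θ are both identified with M₁.
  record ModelOverHom (M N : ModelOver) : Set (o ⊔ ℓ ⊔ o′ ⊔ s) where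
    field
      η        : ∀ X → F₀ (model M) X → F₀ (model N) X
      natural  : ∀ {X Y} (f : X Θ.⇒ Y) x → η Y (F₁ (model M) f x) ≡ F₁ (model N) f (η X x)
      restrict : ∀ X x → transport (eq₀ (over N) X) (η (F₀ θ X) x)
                       ≡ transport (eq₀ (over M) X) x

  open ModelOverHom

  ModOver : Category (o ⊔ q ⊔ ℓ ⊔ e ⊔ o′ ⊔ q′ ⊔ ℓ′ ⊔ e′ ⊔ lsuc s) (o ⊔ ℓ ⊔ o′ ⊔ s) (o ⊔ s)
  ModOver = record
    { Obj = ModelOver
    ; _⇒_ = ModelOverHom
    ; _≈_ = λ m n → ∀ X x → η m X x ≡ η n X x
    ; id  = record { η = λ _ x → x ; natural = λ _ _ → refl ; restrict = λ _ _ → refl }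
    ; _∘_ = λ n m → record
      { η        = λ X x → η n X (η m X x)
      ; natural  = λ f x → trans (cong (η n _) (natural m f x)) (natural n f _)
      ; restrict = λ X x → trans (restrict n X _) (restrict m X x) }
    ; ≈-equiv = record
      { refl  = λ _ _ → refl
      ; sym   = λ p X x → sym (p X x)
      ; trans = λ p r X x → trans (p X x) (r X x) }
    ; ∘-resp-≈  = λ {_} {_} {_} {n} p r X x → trans (cong (η n X) (r X x)) (p X _)
    ; assoc     = λ _ _ → refl
    ; identityˡ = λ _ _ → refl
    ; identityʳ = λ _ _ → refl
    }

  -- Mod(Θ)|_{M₁} regarded as a set: its elements are the models over M₁,
  -- and two of them are equal when they are equal as functors.
  ModOverSetoid : Setoid _ _
  ModOverSetoid = record
    { Carrier       = ModelOver
    ; _≈_           = λ M N → model M ≗ model N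
    ; isEquivalence = record { refl = 𝕄.refl ; sym = 𝕄.sym ; trans = 𝕄.trans }
    }
    where module 𝕄 = Setoid (morphismSetoid Θ (SetTheory {s}))

open ModelOver public

-- pure-coe belongs to the closure under identities: coe r is the identity
-- of X = Y.

record DecoratedTheory (o q ℓ e p : Level) : Set (lsuc (o ⊔ q ⊔ ℓ ⊔ e ⊔ p)) where
  field
    Θ : Theory o q ℓ e
  open Theory Θ
  field
    Pure        : ∀ {X Y} → X ⇒ Y → Set p
    pure-resp-≈ : ∀ {X Y} {f g : X ⇒ Y} → f ≈ g → Pure f → Pure g
    pure-id     : ∀ {X} → Pure (id {X})
    pure-coe    : ∀ {X Y} (r : X ≈ₒ Y) → Pure (coe r)
    pure-∘      : ∀ {X Y Z} {g : Y ⇒ Z} {f : X ⇒ Y} → Pure g → Pure f → Pure (g ∘ f)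
    pure-π      : ∀ {n} {Xs : Vector Obj n} i → Pure (π {Xs = Xs} i)
    pure-tuple  : ∀ {n Z} {Xs : Vector Obj n} {fs : ∀ i → Z ⇒ Xs i} →
                  (∀ i → Pure (fs i)) → Pure (tuple fs)

  Θ₀ : Theory o q (ℓ ⊔ p) e
  Θ₀ = record
    { category = record
      { Obj       = Obj
      ; _⇒_       = λ X Y → Σ (X ⇒ Y) Pure
      ; _≈_       = λ f g → proj₁ f ≈ proj₁ g
      ; id        = id , pure-id
      ; _∘_       = λ g f → proj₁ g ∘ proj₁ f , pure-∘ (proj₂ g) (proj₂ f)
      ; ≈-equiv   = record { refl = ≈-refl ; sym = ≈-sym ; trans = ≈-trans }
      ; ∘-resp-≈  = ∘-resp-≈
      ; assoc     = assoc
      ; identityˡ = identityˡ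
      ; identityʳ = identityʳ
      }
    ; _≈ₒ_         = _≈ₒ_
    ; ≈ₒ-equiv     = ≈ₒ-equiv
    ; coe          = λ r → coe r , pure-coe r
    ; coe-id       = coe-id
    ; coe-∘        = coe-∘
    ; prod         = prod
    ; prod-cong    = prod-cong
    ; π            = λ i → π i , pure-π i
    ; π-coe        = π-coe
    ; tuple        = λ fs → tuple (λ i → proj₁ (fs i)) , pure-tuple (λ i → proj₂ (fs i))
    ; π-tuple      = λ fs → π-tuple (λ i → proj₁ (fs i))
    ; tuple-unique = λ fs h → tuple-unique (λ i → proj₁ (fs i)) (proj₁ h)
    }

  inclusion : Morphism Θ₀ Θ
  inclusion = record
    { F₀        = λ X → X
    ; F₁        = proj₁
    ; F₁-resp-≈ = λ f≈g → f≈g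
    ; F₁-id     = ≈-refl
    ; F₁-∘      = ≈-refl
    ; F₀-cong   = λ r → r
    ; F₁-coe    = λ _ → ≈-refl
    ; F₀-prod   = λ _ → ≈ₒ-refl
    ; F₁-π      = λ _ _ → ≈-trans (≈-sym identityʳ) (∘-resp-≈ ≈-refl (≈-sym (coe-id _)))
    }

module Exp {o q ℓ e p : Level} (D : DecoratedTheory o q ℓ e p) where

  open DecoratedTheory D
  private
    module S  = Theory Θ
    module S₀ = Theory Θ₀

  -- Θᴬ is the theory freely generated by the given data: types and terms
  -- are those built from the generators by the operations of a theory, and
  -- _≈ₜ_ and _≈_ are the least equalities making the relations hold.
  data Ty : Set o where
    ι    : S.Obj → Ty
    A    : Ty
    prod : ∀ {n} → Vector Ty n → Ty

  infix 4 _≈ₜ_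
  data _≈ₜ_ : Ty → Ty → Set (o ⊔ q) where
    ≈ₜ-refl   : ∀ {T} → T ≈ₜ T
    ≈ₜ-sym    : ∀ {T U} → T ≈ₜ U → U ≈ₜ T
    ≈ₜ-trans  : ∀ {T U V} → T ≈ₜ U → U ≈ₜ V → T ≈ₜ V
    prod-cong : ∀ {n} {Ts Us : Vector Ty n} → (∀ i → Ts i ≈ₜ Us i) → prod Ts ≈ₜ prod Us
    ι-cong    : ∀ {X Y} → X S.≈ₒ Y → ι X ≈ₜ ι Y
    ι-prod    : ∀ {n} (Xs : Vector S.Obj n) → ι (S.prod Xs) ≈ₜ prod (λ i → ι (Xs i))

  infix 20 A×_
  A×_ : S.Obj → Ty
  A× X = prod (A ∷ ι X ∷ [])

  infix  4 _⇒_
  infixr 9 _∘_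
  infix  25 _′
  data _⇒_ : Ty → Ty → Set (o ⊔ q ⊔ ℓ ⊔ p) where
    id    : ∀ {T} → T ⇒ T
    _∘_   : ∀ {T U V} → U ⇒ V → T ⇒ U → T ⇒ V
    coe   : ∀ {T U} → T ≈ₜ U → T ⇒ U
    π     : ∀ {n} {Ts : Vector Ty n} (i : Fin n) → prod Ts ⇒ Ts i
    tuple : ∀ {n V} {Ts : Vector Ty n} → (∀ i → V ⇒ Ts i) → V ⇒ prod Ts
    ι₁    : ∀ {X Y} → X S₀.⇒ Y → ι X ⇒ ι Y
    _′    : ∀ {X Y} → X S.⇒ Y → A× X ⇒ ι Y

  pr : ∀ X → A× X ⇒ A
  pr X = π zero

  ε : ∀ X → A× X ⇒ ι X
  ε X = π (suc zero)

  ⟨_,_⟩ : ∀ {V X} → V ⇒ A → V ⇒ ι X → V ⇒ A× X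
  ⟨_,_⟩ {V} {X} a x = tuple components
    where
    components : ∀ i → V ⇒ (A ∷ ι X ∷ []) i
    components zero       = a
    components (suc zero) = x

  -- The ι₁- constructors make ι and ι₁ a morphism of theories Θ₀ → Θᴬ.  In
  -- ′-tuple the two terms have codomains ι (S.prod Ys) and prod (ι ∘ Ys),
  -- which are equal types by ι-prod.
  infix 4 _≈_
  data _≈_ : ∀ {T U} → T ⇒ U → T ⇒ U → Set (o ⊔ q ⊔ ℓ ⊔ e ⊔ p) where
    ≈-refl    : ∀ {T U} {f : T ⇒ U} → f ≈ f
    ≈-sym     : ∀ {T U} {f g : T ⇒ U} → f ≈ g → g ≈ f
    ≈-trans   : ∀ {T U} {f g h : T ⇒ U} → f ≈ g → g ≈ h → f ≈ h
    ∘-resp-≈  : ∀ {T U V} {g g₁ : U ⇒ V} {f f₁ : T ⇒ U} →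
                g ≈ g₁ → f ≈ f₁ → g ∘ f ≈ g₁ ∘ f₁
    assoc     : ∀ {T U V W} {h : V ⇒ W} {g : U ⇒ V} {f : T ⇒ U} →
                (h ∘ g) ∘ f ≈ h ∘ (g ∘ f)
    identityˡ : ∀ {T U} {f : T ⇒ U} → id ∘ f ≈ f
    identityʳ : ∀ {T U} {f : T ⇒ U} → f ∘ id ≈ f
    coe-id    : ∀ {T} (r : T ≈ₜ T) → coe r ≈ id
    coe-∘     : ∀ {T U V} (r : T ≈ₜ U) (t : U ≈ₜ V) (u : T ≈ₜ V) → coe t ∘ coe r ≈ coe u
    π-coe     : ∀ {n} {Ts Us : Vector Ty n} (r : ∀ i → Ts i ≈ₜ Us i) i →
                π {Ts = Us} i ∘ coe (prod-cong r) ≈ coe (r i) ∘ π {Ts = Ts} i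
    π-tuple   : ∀ {n V} {Ts : Vector Ty n} (fs : ∀ i → V ⇒ Ts i) i →
                π {Ts = Ts} i ∘ tuple fs ≈ fs i
    tuple-unique : ∀ {n V} {Ts : Vector Ty n} (fs : ∀ i → V ⇒ Ts i) (h : V ⇒ prod Ts) →
                   (∀ i → π {Ts = Ts} i ∘ h ≈ fs i) → h ≈ tuple fs
    ι₁-resp-≈ : ∀ {X Y} {f g : X S₀.⇒ Y} → f S₀.≈ g → ι₁ f ≈ ι₁ g
    ι₁-id     : ∀ {X} → ι₁ (S₀.id {X}) ≈ id
    ι₁-∘      : ∀ {X Y Z} {g : Y S₀.⇒ Z} {f : X S₀.⇒ Y} →
                ι₁ (g S₀.∘ f) ≈ ι₁ g ∘ ι₁ f
    ι₁-coe    : ∀ {X Y} (r : X S.≈ₒ Y) → ι₁ (S₀.coe r) ≈ coe (ι-cong r)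
    ι₁-π      : ∀ {n} (Xs : Vector S.Obj n) i →
                ι₁ (S₀.π {Xs = Xs} i) ≈ π {Ts = λ j → ι (Xs j)} i ∘ coe (ι-prod Xs)
    ′-resp-≈  : ∀ {X Y} {f g : X S.⇒ Y} → f S.≈ g → f ′ ≈ g ′
    ′-pure    : ∀ {X Y} (f : X S₀.⇒ Y) → (proj₁ f) ′ ≈ ι₁ f ∘ ε X
    ′-∘       : ∀ {X Y Z} (f : X S.⇒ Y) (g : Y S.⇒ Z) →
                (g S.∘ f) ′ ≈ g ′ ∘ ⟨ pr X , f ′ ⟩
    ′-tuple   : ∀ {n X} {Ys : Vector S.Obj n} (fs : ∀ i → X S.⇒ Ys i) →
                coe (ι-prod Ys) ∘ (S.tuple fs) ′ ≈ tuple (λ i → (fs i) ′)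

  Θᴬ : Theory o (o ⊔ q) (o ⊔ q ⊔ ℓ ⊔ p) (o ⊔ q ⊔ ℓ ⊔ e ⊔ p)
  Θᴬ = record
    { category = record
      { Obj       = Ty
      ; _⇒_       = _⇒_
      ; _≈_       = _≈_
      ; id        = id
      ; _∘_       = _∘_
      ; ≈-equiv   = record { refl = ≈-refl ; sym = ≈-sym ; trans = ≈-trans }
      ; ∘-resp-≈  = ∘-resp-≈
      ; assoc     = assoc
      ; identityˡ = identityˡ
      ; identityʳ = identityʳ
      }
    ; _≈ₒ_         = _≈ₜ_
    ; ≈ₒ-equiv     = record { refl = ≈ₜ-refl ; sym = ≈ₜ-sym ; trans = ≈ₜ-trans }
    ; coe          = coe
    ; coe-id       = coe-id
    ; coe-∘        = coe-∘
    ; prod         = prod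
    ; prod-cong    = prod-cong
    ; π            = π
    ; π-coe        = π-coe
    ; tuple        = tuple
    ; π-tuple      = π-tuple
    ; tuple-unique = tuple-unique
    }

  canonical : Morphism Θ₀ Θᴬ
  canonical = record
    { F₀        = ι
    ; F₁        = ι₁
    ; F₁-resp-≈ = ι₁-resp-≈
    ; F₁-id     = ι₁-id
    ; F₁-∘      = ι₁-∘
    ; F₀-cong   = ι-cong
    ; F₁-coe    = ι₁-coe
    ; F₀-prod   = ι-prod
    ; F₁-π      = ι₁-π
    }

  -- M(f′)(α , –), where M(A × X) is identified with M(A) × M(X)
  slice : ∀ {s} (M : Model s Θᴬ) → F₀ M A →
          ∀ {X Y} → X S.⇒ Y → F₀ M (ι X) → F₀ M (ι Y)
  slice M α {X} f x = F₁ M (f ′) (transport (sym (F₀-prod M (A ∷ ι X ∷ []))) (α , x , tt))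

{-# OPTIONS --safe #-}

-- An element α of K(A) amounts to a way of slicing a model K of Θᴬ into a
-- model K(–′)(α , –) of Θ.  Conversely a model M of Θ extends to a model of
-- Θᴬ in which A is a singleton, and the morphisms over M₀ from this
-- extension to K are exactly the α ∈ K(A) whose slice is M.  If K is
-- terminal there is one such α for each M.

module Submission where

open import Defs
open import Level using (Level)
open import Data.Fin.Base using (zero; suc)
open import Data.Product using (Σ-syntax; _×_; _,_; proj₁; proj₂)
open import Data.Unit.Polymorphic.Base using (⊤; tt)
open import Data.Vec.Functional using (Vector; []; _∷_)
open import Function.Bundles using (Bijection)
open import Relation.Binary.Bundles using (Setoid)
open import Relation.Binary.PropositionalEquality
  using (_≡_; refl; sym; trans; cong; cong₂; setoid; module ≡-Reasoning)

open ≡-Reasoning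

private
  variable
    o q ℓ e p s : Level

-- Transports and finite products of sets.

module _ {s : Level} where
  open Theory (SetTheory {s})

  -- The third proof in `coe-∘` is arbitrary, so with `refl` as the first one it compares any two
  -- proofs. This rests on uniqueness of identity proofs.
  transport-irrelevant : {X Y : Set s} (r t : X ≡ Y) (x : X) → transport r x ≡ transport t x
  transport-irrelevant r t = coe-∘ refl r t

  transport-symʳ : {X Y : Set s} (r : X ≡ Y) (y : Y) → transport r (transport (sym r) y) ≡ y
  transport-symʳ r = coe-∘ (sym r) r refl

  transport-symˡ : {X Y : Set s} (r : X ≡ Y) (x : X) → transport (sym r) (transport r x) ≡ x
  transport-symˡ r = coe-∘ r (sym r) refl

  transport-adjoint : {X Y : Set s} (r : X ≡ Y) {x : X} {y : Y} →
                      transport r x ≡ y → x ≡ transport (sym r) y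
  transport-adjoint r refl = sym (transport-symˡ r _)

  -- An element of the product is a map out of the one-point set `⊤`; both `xs` and `ys` are then
  -- the unique tuple of the components of `ys`.
  ∏-ext : ∀ {n} {Xs : Vector (Set s) n} {xs ys : ∏ Xs} →
          (∀ i → ∏-π {Xs = Xs} i xs ≡ ∏-π {Xs = Xs} i ys) → xs ≡ ys
  ∏-ext {Xs = Xs} {xs} {ys} h = trans
    (tuple-unique {Z = ⊤} {Xs = Xs} (λ i _ → ∏-π {Xs = Xs} i ys) (λ _ → xs) (λ i _ → h i) tt)
    (sym (tuple-unique {Z = ⊤} {Xs = Xs} (λ i _ → ∏-π {Xs = Xs} i ys) (λ _ → ys) (λ _ _ → refl) tt))

  ∏-map : ∀ {n} {Xs Ys : Vector (Set s) n} → (∀ i → Xs i → Ys i) → ∏ Xs → ∏ Ys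
  ∏-map {Xs = Xs} fs = ∏-tuple (λ i xs → fs i (∏-π {Xs = Xs} i xs))

  ∏-π-map : ∀ {n} {Xs Ys : Vector (Set s) n} (fs : ∀ i → Xs i → Ys i) i xs →
            ∏-π {Xs = Ys} i (∏-map fs xs) ≡ fs i (∏-π {Xs = Xs} i xs)
  ∏-π-map {Xs = Xs} {Ys} fs = π-tuple {Xs = Ys} (λ i xs → fs i (∏-π {Xs = Xs} i xs))

  ∏-map-transport : ∀ {n} {Xs Ys : Vector (Set s) n} (r : ∀ i → Xs i ≡ Ys i) xs →
                    ∏-map (λ i → transport (r i)) xs ≡ transport (∏-cong r) xs
  ∏-map-transport {Xs = Xs} {Ys} r xs = ∏-ext {Xs = Ys} λ i →
    trans (∏-π-map {Ys = Ys} (λ i → transport (r i)) i xs) (sym (π-coe {Xs = Xs} {Ys} r i xs))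

  -- Checked on each component, where it is `sq`. It serves the `prod-cong` case of `extend-η-coe`.
  ∏-map-square : ∀ {n} {Xs Ys Xs′ Ys′ : Vector (Set s) n}
                 (fs : ∀ i → Xs i → Ys i) (gs : ∀ i → Xs′ i → Ys′ i)
                 (r : ∀ i → Xs i ≡ Xs′ i) (t : ∀ i → Ys i ≡ Ys′ i) →
                 (∀ i x → gs i (transport (r i) x) ≡ transport (t i) (fs i x)) →
                 ∀ xs → ∏-map gs (transport (∏-cong r) xs) ≡ transport (∏-cong t) (∏-map fs xs)
  ∏-map-square {Xs = Xs} {Ys} {Xs′} {Ys′} fs gs r t sq xs = ∏-ext {Xs = Ys′} λ i → begin
    ∏-π {Xs = Ys′} i (∏-map gs (transport (∏-cong r) xs))
      ≡⟨ ∏-π-map {Ys = Ys′} gs i _ ⟩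
    gs i (∏-π {Xs = Xs′} i (transport (∏-cong r) xs))
      ≡⟨ cong (gs i) (π-coe {Xs = Xs} {Xs′} r i xs) ⟩
    gs i (transport (r i) (∏-π {Xs = Xs} i xs))
      ≡⟨ sq i _ ⟩
    transport (t i) (fs i (∏-π {Xs = Xs} i xs))
      ≡⟨ cong (transport (t i)) (∏-π-map {Ys = Ys} fs i xs) ⟨
    transport (t i) (∏-π {Xs = Ys} i (∏-map fs xs))
      ≡⟨ π-coe {Xs = Ys} {Ys′} t i (∏-map fs xs) ⟨
    ∏-π {Xs = Ys′} i (transport (∏-cong t) (∏-map fs xs)) ∎

-- Models of a theory: tuples and equality of models.

module _ {Θ : Theory o q ℓ e} where
  private module Θ = Theory Θ

  -- A model preserves projections by `F₁-π`; uniqueness of tuples in sets turns this into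
  -- preservation of tuples.
  F₁-tuple : (M : Model s Θ) → ∀ {n Z} {Xs : Vector Θ.Obj n} (fs : ∀ i → Z Θ.⇒ Xs i) z →
             transport (F₀-prod M Xs) (F₁ M (Θ.tuple fs) z) ≡ ∏-tuple (λ i → F₁ M (fs i)) z
  F₁-tuple M {Xs = Xs} fs = Theory.tuple-unique SetTheory {Xs = λ i → F₀ M (Xs i)}
    (λ i → F₁ M (fs i)) (λ z → transport (F₀-prod M Xs) (F₁ M (Θ.tuple fs) z)) λ i z → begin
      ∏-π {Xs = λ i → F₀ M (Xs i)} i (transport (F₀-prod M Xs) (F₁ M (Θ.tuple fs) z))
        ≡⟨ M.F₁-π Xs i _ ⟨
      F₁ M (Θ.π i) (F₁ M (Θ.tuple fs) z)
        ≡⟨ M.F₁-∘ z ⟨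
      F₁ M (Θ.π i Θ.∘ Θ.tuple fs) z
        ≡⟨ M.F₁-resp-≈ (Θ.π-tuple fs i) z ⟩
      F₁ M (fs i) z ∎
    where module M = Morphism M

  -- For each term `eq₁` brings its own proofs of the type equalities. Irrelevance of transport
  -- replaces them by `eq₀`, so that an equality of models acts as a natural transformation.
  ≗-natural : {M N : Model s Θ} (h : M ≗ N) → ∀ {X Y} (f : X Θ.⇒ Y) x →
              transport (eq₀ h Y) (F₁ M f x) ≡ F₁ N f (transport (eq₀ h X) x)
  ≗-natural {M = M} {N} h f x = begin
    transport (eq₀ h _) (F₁ M f x)  ≡⟨ transport-irrelevant (eq₀ h _) cod≈ _ ⟩
    transport cod≈ (F₁ M f x)       ≡⟨ square x ⟩
    F₁ N f (transport dom≈ x)       ≡⟨ cong (F₁ N f) (transport-irrelevant dom≈ (eq₀ h _) x) ⟩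
    F₁ N f (transport (eq₀ h _) x)  ∎
    where open Theory._≋_ (eq₁ h f)

module _ (D : DecoratedTheory o q ℓ e p) where
  open DecoratedTheory D
  open Exp D
  private module S = Theory Θ

  -- Slices of a model of `Θᴬ` at an element of `A`.

  module _ (K : Model s Θᴬ) where
    private module K = Morphism K

    -- The argument at which `slice` evaluates `f ′`: `slice K α f x` unfolds to
    -- `F₁ K (f ′) (pair α x)`.
    pair : ∀ {X} → F₀ K A → F₀ K (ι X) → F₀ K (A× X)
    pair {X} a x = transport (sym (F₀-prod K (A ∷ ι X ∷ []))) (a , x , tt)

    pr-pair : ∀ {X} a (x : F₀ K (ι X)) → F₁ K (pr X) (pair a x) ≡ a
    pr-pair {X} a x = trans (K.F₁-π (A ∷ ι X ∷ []) zero _)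
      (cong proj₁ (transport-symʳ (F₀-prod K (A ∷ ι X ∷ [])) (a , x , tt)))

    ε-pair : ∀ {X} a (x : F₀ K (ι X)) → F₁ K (ε X) (pair a x) ≡ x
    ε-pair {X} a x = trans (K.F₁-π (A ∷ ι X ∷ []) (suc zero) _)
      (cong (λ t → proj₁ (proj₂ t)) (transport-symʳ (F₀-prod K (A ∷ ι X ∷ [])) (a , x , tt)))

    pair-η : ∀ {X} (z : F₀ K (A× X)) → z ≡ pair (F₁ K (pr X) z) (F₁ K (ε X) z)
    pair-η {X} z = transport-adjoint (F₀-prod K (A ∷ ι X ∷ []))
      (cong₂ _,_ (sym (K.F₁-π (A ∷ ι X ∷ []) zero z))
        (cong₂ _,_ (sym (K.F₁-π (A ∷ ι X ∷ []) (suc zero) z)) refl))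

    F₁-⟨,⟩ : ∀ {V X} (a : V ⇒ A) (x : V ⇒ ι X) z →
             F₁ K ⟨ a , x ⟩ z ≡ pair (F₁ K a z) (F₁ K x z)
    F₁-⟨,⟩ {X = X} a x z = trans (pair-η (F₁ K ⟨ a , x ⟩ z)) (cong₂ pair
      (trans (sym (K.F₁-∘ {g = pr X} {⟨ a , x ⟩} z)) (K.F₁-resp-≈ (π-tuple _ zero) z))
      (trans (sym (K.F₁-∘ {g = ε X} {⟨ a , x ⟩} z)) (K.F₁-resp-≈ (π-tuple _ (suc zero)) z)))

    module _ (α : F₀ K A) where

      -- By the relation for pure terms `f ′` factors through `ε X`, which forgets `α`. Hence all
      -- slices of `K` agree on pure terms.
      slice-pure : ∀ {X Y} (f : Theory._⇒_ Θ₀ X Y) x → slice K α (proj₁ f) x ≡ F₁ K (ι₁ f) x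
      slice-pure {X} f x = begin
        F₁ K (proj₁ f ′) (pair α x)          ≡⟨ K.F₁-resp-≈ (′-pure f) _ ⟩
        F₁ K (ι₁ f ∘ ε X) (pair α x)         ≡⟨ K.F₁-∘ _ ⟩
        F₁ K (ι₁ f) (F₁ K (ε X) (pair α x))  ≡⟨ cong (F₁ K (ι₁ f)) (ε-pair α x) ⟩
        F₁ K (ι₁ f) x                        ∎

      -- The relation for composites hands the `A`-component on through `pr X`, so both factors are
      -- evaluated at the same `α`.
      slice-∘ : ∀ {X Y Z} (f : X S.⇒ Y) (g : Y S.⇒ Z) x →
                slice K α (g S.∘ f) x ≡ slice K α g (slice K α f x)
      slice-∘ {X} f g x = begin
        F₁ K ((g S.∘ f) ′) (pair α x)                ≡⟨ K.F₁-resp-≈ (′-∘ f g) _ ⟩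
        F₁ K (g ′ ∘ ⟨ pr X , f ′ ⟩) (pair α x)       ≡⟨ K.F₁-∘ _ ⟩
        F₁ K (g ′) (F₁ K ⟨ pr X , f ′ ⟩ (pair α x))  ≡⟨ cong (F₁ K (g ′)) (F₁-⟨,⟩ (pr X) (f ′) _) ⟩
        F₁ K (g ′) (pair (F₁ K (pr X) (pair α x)) (F₁ K (f ′) (pair α x)))
          ≡⟨ cong (λ a → F₁ K (g ′) (pair a (F₁ K (f ′) (pair α x)))) (pr-pair α x) ⟩
        F₁ K (g ′) (pair α (F₁ K (f ′) (pair α x)))  ∎

      -- Identities, coercions and projections are pure, so `slice-pure` reduces their laws to those
      -- of `K ∘ᴹ canonical`.
      sliceModel : Model s Θ
      sliceModel = record
        { F₀        = λ X → F₀ K (ι X)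
        ; F₁        = slice K α
        ; F₁-resp-≈ = λ f≈g x → K.F₁-resp-≈ (′-resp-≈ f≈g) _
        ; F₁-id     = λ x → trans (slice-pure S₀.id x)
                            (trans (K.F₁-resp-≈ ι₁-id x) (K.F₁-id x))
        ; F₁-∘      = λ {_} {_} {_} {g} {f} → slice-∘ f g
        ; F₀-cong   = λ r → K.F₀-cong (ι-cong r)
        ; F₁-coe    = λ r x → trans (slice-pure (S₀.coe r) x)
                              (trans (K.F₁-resp-≈ (ι₁-coe r) x) (K.F₁-coe _ x))
        ; F₀-prod   = F₀-prod (K ∘ᴹ canonical)
        ; F₁-π      = λ Xs i x → trans (slice-pure (S₀.π i) x)
                                 (Morphism.F₁-π (K ∘ᴹ canonical) Xs i x)
        }
        where module S₀ = Theory Θ₀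

  sliceOver : {M₀ : Model s Θ₀} (K : ModelOver canonical M₀) →
              F₀ (model K) A → ModelOver inclusion M₀
  sliceOver K α = record
    { model = sliceModel (model K) α
    ; over  = record
      { eq₀ = eq₀ (over K)
      ; eq₁ = λ f → ≋-trans (≈⇒≋ (slice-pure (model K) α f)) (eq₁ (over K) f) } }
    where open Theory SetTheory using (≋-trans; ≈⇒≋)

  -- Extension of a model of `Θ` by a singleton for `A`.

  module _ (M : Model s Θ) where
    private module M = Morphism M
    open Theory (SetTheory {s}) using () renaming
      ( coe-id to transport-id; coe-∘ to transport-∘; π-coe to ∏-π-transport
      ; π-tuple to ∏-π-tuple; tuple-unique to ∏-tuple-unique )

    -- Generated products go to products of sets on the nose, so `F₀-prod` of the extension is
    -- `refl`; the comparison of `M` enters through `ι-prod`.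
    ext₀ : Ty → Set s
    ext₀ (ι X)     = F₀ M X
    ext₀ A         = ⊤
    ext₀ (prod Ts) = ∏ (λ i → ext₀ (Ts i))

    ext₀-cong : ∀ {T U} → T ≈ₜ U → ext₀ T ≡ ext₀ U
    ext₀-cong ≈ₜ-refl        = refl
    ext₀-cong (≈ₜ-sym r)     = sym (ext₀-cong r)
    ext₀-cong (≈ₜ-trans r t) = trans (ext₀-cong r) (ext₀-cong t)
    ext₀-cong (prod-cong r)  = ∏-cong (λ i → ext₀-cong (r i))
    ext₀-cong (ι-cong r)     = M.F₀-cong r
    ext₀-cong (ι-prod Xs)    = F₀-prod M Xs

    ext₁ : ∀ {T U} → T ⇒ U → ext₀ T → ext₀ U
    ext₁ id                z           = z
    ext₁ (g ∘ f)           z           = ext₁ g (ext₁ f z)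
    ext₁ (coe r)           z           = transport (ext₀-cong r) z
    ext₁ (π {Ts = Ts} i)   z           = ∏-π {Xs = λ j → ext₀ (Ts j)} i z
    ext₁ (tuple fs)        z           = ∏-tuple (λ i → ext₁ (fs i)) z
    ext₁ (ι₁ f)            x           = F₁ M (proj₁ f) x
    ext₁ (f ′)             (_ , x , _) = F₁ M f x

    -- Each `f ′` ignores its `A`-component, so the relations on `′` reduce to the functor laws of
    -- `M` and its preservation of tuples.
    ext₁-resp-≈ : ∀ {T U} {f g : T ⇒ U} → f ≈ g → ∀ z → ext₁ f z ≡ ext₁ g z
    ext₁-resp-≈ ≈-refl                z = refl
    ext₁-resp-≈ (≈-sym f≈g)           z = sym (ext₁-resp-≈ f≈g z)
    ext₁-resp-≈ (≈-trans f≈g g≈h)     z = trans (ext₁-resp-≈ f≈g z) (ext₁-resp-≈ g≈h z)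
    ext₁-resp-≈ (∘-resp-≈ {g = g} g≈ f≈) z =
      trans (cong (ext₁ g) (ext₁-resp-≈ f≈ z)) (ext₁-resp-≈ g≈ _)
    ext₁-resp-≈ assoc                 z = refl
    ext₁-resp-≈ identityˡ             z = refl
    ext₁-resp-≈ identityʳ             z = refl
    ext₁-resp-≈ (coe-id r)            z = transport-id (ext₀-cong r) z
    ext₁-resp-≈ (coe-∘ r t u)         z = transport-∘ (ext₀-cong r) (ext₀-cong t) (ext₀-cong u) z
    ext₁-resp-≈ (π-coe {Ts = Ts} {Us} r i) z =
      ∏-π-transport {Xs = λ j → ext₀ (Ts j)} {λ j → ext₀ (Us j)} (λ j → ext₀-cong (r j)) i z
    ext₁-resp-≈ (π-tuple {Ts = Ts} fs i) z =
      ∏-π-tuple {Xs = λ j → ext₀ (Ts j)} (λ j → ext₁ (fs j)) i z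
    ext₁-resp-≈ (tuple-unique {Ts = Ts} fs h h≈) z =
      ∏-tuple-unique {Xs = λ j → ext₀ (Ts j)} (λ j → ext₁ (fs j)) (ext₁ h)
        (λ i → ext₁-resp-≈ (h≈ i)) z
    ext₁-resp-≈ (ι₁-resp-≈ f≈g)       x = M.F₁-resp-≈ f≈g x
    ext₁-resp-≈ ι₁-id                 x = M.F₁-id x
    ext₁-resp-≈ ι₁-∘                  x = M.F₁-∘ x
    ext₁-resp-≈ (ι₁-coe r)            x = M.F₁-coe r x
    ext₁-resp-≈ (ι₁-π Xs i)           x = M.F₁-π Xs i x
    ext₁-resp-≈ (′-resp-≈ f≈g)        z = M.F₁-resp-≈ f≈g _
    ext₁-resp-≈ (′-pure f)            z = refl
    ext₁-resp-≈ (′-∘ f g)             z = M.F₁-∘ _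
    -- `F₁-tuple` yields a tuple of maps out of `F₀ M X`, while the goal has one of maps out of the
    -- product with `⊤`. As `∏-tuple` does not reduce for a variable `n`, uniqueness identifies
    -- their values.
    ext₁-resp-≈ (′-tuple {Ys = Ys} fs) z = trans (F₁-tuple M fs (proj₁ (proj₂ z)))
      (∏-tuple-unique {Xs = λ j → F₀ M (Ys j)} (λ i → ext₁ (fs i ′))
        (λ w → ∏-tuple (λ i → F₁ M (fs i)) (proj₁ (proj₂ w)))
        (λ i w → ∏-π-tuple {Xs = λ j → F₀ M (Ys j)} (λ j → F₁ M (fs j)) i _) z)

    extend : Model s Θᴬ
    extend = record
      { F₀        = ext₀
      ; F₁        = ext₁
      ; F₁-resp-≈ = ext₁-resp-≈
      ; F₁-id     = λ _ → refl
      ; F₁-∘      = λ _ → refl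
      ; F₀-cong   = ext₀-cong
      ; F₁-coe    = λ _ _ → refl
      ; F₀-prod   = λ _ → refl
      ; F₁-π      = λ _ _ _ → refl
      }

  extendOver : {M₀ : Model s Θ₀} → ModelOver inclusion M₀ → ModelOver canonical M₀
  extendOver M = record
    { model = extend (model M)
    -- On `ι X` and `ι₁ f` the extension unfolds to `M`, so the same proofs serve.
    ; over  = record { eq₀ = eq₀ (over M) ; eq₁ = eq₁ (over M) } }

  -- Morphisms from the extension to `K` and elements of `A`.

  module _ (M : Model s Θ) (K : Model s Θᴬ) (α : F₀ K A) (M≗ : M ≗ sliceModel K α) where
    private module K = Morphism K

    -- Naturality at the projections forces the clause for products. That `M` equals the slice only
    -- by `M≗` lets the injectivity proof use two elements with equal slices.
    extend-η : ∀ T → ext₀ M T → F₀ K T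
    extend-η (ι X)     x  = transport (eq₀ M≗ X) x
    extend-η A         _  = α
    extend-η (prod Ts) xs =
      transport (sym (F₀-prod K Ts)) (∏-map (λ i → extend-η (Ts i)) xs)

    -- The `coe` case of naturality. Types equal by `r` may differ as trees, on which `extend-η`
    -- recurses, so the proof is by induction on `r`.
    extend-η-coe : ∀ {T U} (r : T ≈ₜ U) z →
      extend-η U (transport (ext₀-cong M r) z) ≡ transport (K.F₀-cong r) (extend-η T z)
    extend-η-coe {T} ≈ₜ-refl z = transport-irrelevant refl (K.F₀-cong ≈ₜ-refl) (extend-η T z)
    extend-η-coe {T} {U} (≈ₜ-sym r) z = begin
      extend-η U z′
        -- The induction hypothesis is taken at `z′` and solved for `extend-η U z′`.
        ≡⟨ transport-adjoint (K.F₀-cong r) (sym (extend-η-coe r z′)) ⟩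
      transport (sym (K.F₀-cong r)) (extend-η T (transport (ext₀-cong M r) z′))
        ≡⟨ cong (λ w → transport (sym (K.F₀-cong r)) (extend-η T w))
             (transport-symʳ (ext₀-cong M r) z) ⟩
      transport (sym (K.F₀-cong r)) (extend-η T z)
        ≡⟨ transport-irrelevant (sym (K.F₀-cong r)) (K.F₀-cong (≈ₜ-sym r)) _ ⟩
      transport (K.F₀-cong (≈ₜ-sym r)) (extend-η T z) ∎
      where z′ = transport (sym (ext₀-cong M r)) z
    extend-η-coe {T} {V} (≈ₜ-trans {U = U} r t) z = begin
      extend-η V (transport (trans (ext₀-cong M r) (ext₀-cong M t)) z)
        ≡⟨ cong (extend-η V) (transport-∘ (ext₀-cong M r) (ext₀-cong M t) _ z) ⟨
      extend-η V (transport (ext₀-cong M t) (transport (ext₀-cong M r) z))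
        ≡⟨ extend-η-coe t _ ⟩
      transport (K.F₀-cong t) (extend-η U (transport (ext₀-cong M r) z))
        ≡⟨ cong (transport (K.F₀-cong t)) (extend-η-coe r z) ⟩
      transport (K.F₀-cong t) (transport (K.F₀-cong r) (extend-η T z))
        ≡⟨ transport-∘ (K.F₀-cong r) (K.F₀-cong t) _ _ ⟩
      transport (K.F₀-cong (≈ₜ-trans r t)) (extend-η T z) ∎
      where open Theory SetTheory using () renaming (coe-∘ to transport-∘)
    extend-η-coe (prod-cong {Ts = Ts} {Us} r) xs = begin
      transport (sym (F₀-prod K Us))
        (∏-map (λ i → extend-η (Us i)) (transport (∏-cong (λ i → ext₀-cong M (r i))) xs))
        ≡⟨ cong (transport (sym (F₀-prod K Us)))
             (∏-map-square (λ i → extend-η (Ts i)) (λ i → extend-η (Us i))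
               (λ i → ext₀-cong M (r i)) (λ i → K.F₀-cong (r i))
               (λ i → extend-η-coe (r i)) xs) ⟩
      transport (sym (F₀-prod K Us))
        (transport (∏-cong (λ i → K.F₀-cong (r i))) (∏-map (λ i → extend-η (Ts i)) xs))
        -- Both sides are two successive transports of the same element; each pair is merged into
        -- one transport along a common proof. The cases of `ι` use the same device.
        ≡⟨ transport-∘ (∏-cong (λ i → K.F₀-cong (r i))) (sym (F₀-prod K Us))
             (trans (sym (F₀-prod K Ts)) (K.F₀-cong (prod-cong r))) _ ⟩
      transport (trans (sym (F₀-prod K Ts)) (K.F₀-cong (prod-cong r)))
        (∏-map (λ i → extend-η (Ts i)) xs)
        ≡⟨ transport-∘ (sym (F₀-prod K Ts)) (K.F₀-cong (prod-cong r)) _ _ ⟨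
      transport (K.F₀-cong (prod-cong r))
        (transport (sym (F₀-prod K Ts)) (∏-map (λ i → extend-η (Ts i)) xs)) ∎
      where open Theory SetTheory using () renaming (coe-∘ to transport-∘)
    extend-η-coe (ι-cong {X} {Y} r) x = begin
      transport (eq₀ M≗ Y) (transport (Morphism.F₀-cong M r) x)
        ≡⟨ transport-∘ (Morphism.F₀-cong M r) (eq₀ M≗ Y)
             (trans (eq₀ M≗ X) (K.F₀-cong (ι-cong r))) x ⟩
      transport (trans (eq₀ M≗ X) (K.F₀-cong (ι-cong r))) x
        ≡⟨ transport-∘ (eq₀ M≗ X) (K.F₀-cong (ι-cong r)) _ x ⟨
      transport (K.F₀-cong (ι-cong r)) (transport (eq₀ M≗ X) x) ∎
      where open Theory SetTheory using () renaming (coe-∘ to transport-∘)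
    extend-η-coe (ι-prod Xs) x = begin
      transport (sym P) (∏-map (λ i → transport (eq₀ M≗ (Xs i))) (transport (F₀-prod M Xs) x))
        ≡⟨ cong (transport (sym P)) (∏-map-transport (λ i → eq₀ M≗ (Xs i)) _) ⟩
      transport (sym P) (transport E (transport (F₀-prod M Xs) x))
        ≡⟨ transport-∘ E (sym P) (trans E (sym P)) _ ⟩
      transport (trans E (sym P)) (transport (F₀-prod M Xs) x)
        ≡⟨ transport-∘ (F₀-prod M Xs) (trans E (sym P)) (trans (eq₀ M≗ _) C) x ⟩
      transport (trans (eq₀ M≗ _) C) x
        ≡⟨ transport-∘ (eq₀ M≗ _) C _ x ⟨
      transport C (transport (eq₀ M≗ _) x) ∎
      where
      open Theory SetTheory using () renaming (coe-∘ to transport-∘)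
      P = F₀-prod K (λ i → ι (Xs i))
      E = ∏-cong (λ i → eq₀ M≗ (Xs i))
      C = K.F₀-cong (ι-prod Xs)

    extend-η-natural : ∀ {T U} (f : T ⇒ U) z →
                       extend-η U (ext₁ M f z) ≡ F₁ K f (extend-η T z)
    extend-η-natural id      z = sym (K.F₁-id _)
    extend-η-natural (g ∘ f) z = begin
      extend-η _ (ext₁ M g (ext₁ M f z))  ≡⟨ extend-η-natural g _ ⟩
      F₁ K g (extend-η _ (ext₁ M f z))    ≡⟨ cong (F₁ K g) (extend-η-natural f z) ⟩
      F₁ K g (F₁ K f (extend-η _ z))      ≡⟨ K.F₁-∘ _ ⟨
      F₁ K (g ∘ f) (extend-η _ z)         ∎
    extend-η-natural (coe r) z = trans (extend-η-coe r z) (sym (K.F₁-coe r _))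
    extend-η-natural (π {Ts = Ts} i) xs = begin
      extend-η (Ts i) (∏-π {Xs = λ j → ext₀ M (Ts j)} i xs)
        ≡⟨ ∏-π-map {Ys = λ j → F₀ K (Ts j)} (λ j → extend-η (Ts j)) i xs ⟨
      ∏-π {Xs = λ j → F₀ K (Ts j)} i (∏-map (λ j → extend-η (Ts j)) xs)
        ≡⟨ cong (∏-π {Xs = λ j → F₀ K (Ts j)} i) (transport-symʳ (F₀-prod K Ts) _) ⟨
      ∏-π {Xs = λ j → F₀ K (Ts j)} i (transport (F₀-prod K Ts) (extend-η (prod Ts) xs))
        ≡⟨ K.F₁-π Ts i _ ⟨
      F₁ K (π i) (extend-η (prod Ts) xs) ∎
    -- The comparison `F₀-prod K Ts` is moved across; then both sides lie in a product of sets and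
    -- are compared by their projections.
    extend-η-natural {T} (tuple {Ts = Ts} fs) z = sym (transport-adjoint (F₀-prod K Ts) (begin
      transport (F₀-prod K Ts) (F₁ K (tuple fs) (extend-η T z))
        ≡⟨ F₁-tuple K fs _ ⟩
      ∏-tuple (λ i → F₁ K (fs i)) (extend-η T z)
        ≡⟨ ∏-ext {Xs = λ j → F₀ K (Ts j)} (λ i → begin
             ∏-π {Xs = λ j → F₀ K (Ts j)} i (∏-tuple (λ i → F₁ K (fs i)) (extend-η T z))
               ≡⟨ ∏-π-tuple {Xs = λ j → F₀ K (Ts j)} (λ i → F₁ K (fs i)) i _ ⟩
             F₁ K (fs i) (extend-η T z)
               ≡⟨ extend-η-natural (fs i) z ⟨
             extend-η (Ts i) (ext₁ M (fs i) z)
               ≡⟨ cong (extend-η (Ts i))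
                    (∏-π-tuple {Xs = λ j → ext₀ M (Ts j)} (λ i → ext₁ M (fs i)) i z) ⟨
             extend-η (Ts i) (∏-π {Xs = λ j → ext₀ M (Ts j)} i (ext₁ M (tuple fs) z))
               ≡⟨ ∏-π-map {Ys = λ j → F₀ K (Ts j)} (λ j → extend-η (Ts j)) i _ ⟨
             ∏-π {Xs = λ j → F₀ K (Ts j)} i
               (∏-map (λ j → extend-η (Ts j)) (ext₁ M (tuple fs) z)) ∎) ⟩
      ∏-map (λ i → extend-η (Ts i)) (ext₁ M (tuple fs) z) ∎))
      where open Theory SetTheory using () renaming (π-tuple to ∏-π-tuple)
    extend-η-natural (ι₁ f)  x = trans (≗-natural M≗ (proj₁ f) x) (slice-pure K α f _)
    -- On `A× X` the map `extend-η` unfolds to `pair K α` at the transported element, so this square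
    -- is the one for `M≗`.
    extend-η-natural (f ′)   z = ≗-natural M≗ f (proj₁ (proj₂ z))

  extendHom : {M₀ : Model s Θ₀} (M : ModelOver inclusion M₀) (K : ModelOver canonical M₀)
              (α : F₀ (model K) A) → model M ≗ sliceModel (model K) α →
              ModelOverHom canonical M₀ (extendOver M) K
  extendHom M K α M≗ = record
    { η        = extend-η (model M) (model K) α M≗
    ; natural  = extend-η-natural (model M) (model K) α M≗
    ; restrict = λ X → Theory.coe-∘ SetTheory (eq₀ M≗ X) (eq₀ (over K) X) (eq₀ (over M) X)
    }

  -- A morphism from the extension of M is determined on A × X by its
  -- components on A and on X, so naturality at f ′ identifies M with a slice.
  hom⇒slice : {M₀ : Model s Θ₀} (M : ModelOver inclusion M₀) (K : ModelOver canonical M₀)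
              (h : ModelOverHom canonical M₀ (extendOver M) K) →
              sliceModel (model K) (ModelOverHom.η h A tt) ≗ model M
  hom⇒slice M K h = record { eq₀ = r ; eq₁ = λ {X} {Y} f → mk≋ (r X) (r Y) (square f) }
    where
    open ModelOverHom h
    open Theory SetTheory using (mk≋)
    N = model K
    α = η A tt

    r : ∀ X → F₀ N (ι X) ≡ F₀ (model M) X
    r X = trans (eq₀ (over K) X) (sym (eq₀ (over M) X))

    -- `restrict` says that `η` becomes the identity once both sides are identified with `M₀ X`, and
    -- `r X` passes through `M₀ X`.
    r-η : ∀ X x → transport (r X) (η (ι X) x) ≡ x
    r-η X x = begin
      transport (r X) (η (ι X) x)
        ≡⟨ Theory.coe-∘ SetTheory (eq₀ (over K) X) (sym (eq₀ (over M) X)) _ _ ⟨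
      transport (sym (eq₀ (over M) X)) (transport (eq₀ (over K) X) (η (ι X) x))
        ≡⟨ cong (transport (sym (eq₀ (over M) X))) (restrict X x) ⟩
      transport (sym (eq₀ (over M) X)) (transport (eq₀ (over M) X) x)
        ≡⟨ transport-symˡ (eq₀ (over M) X) x ⟩
      x ∎

    η-pair : ∀ X x → η (A× X) (tt , x , tt) ≡ pair N α (η (ι X) x)
    η-pair X x = trans (pair-η N _)
      (cong₂ (pair N) (sym (natural (pr X) (tt , x , tt))) (sym (natural (ε X) (tt , x , tt))))

    square : ∀ {X Y} (f : X S.⇒ Y) x →
             transport (r Y) (slice N α f x) ≡ F₁ (model M) f (transport (r X) x)
    square {X} {Y} f x = begin
      transport (r Y) (slice N α f x)
        -- Naturality speaks only of values of `η`, so `x` is first written as one.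
        ≡⟨ cong (λ w → transport (r Y) (slice N α f w)) x≡ ⟩
      transport (r Y) (slice N α f (η (ι X) y))
        ≡⟨ cong (λ w → transport (r Y) (F₁ N (f ′) w)) (η-pair X y) ⟨
      transport (r Y) (F₁ N (f ′) (η (A× X) (tt , y , tt)))
        ≡⟨ cong (transport (r Y)) (natural (f ′) (tt , y , tt)) ⟨
      transport (r Y) (η (ι Y) (F₁ (model M) f y))
        ≡⟨ r-η Y _ ⟩
      F₁ (model M) f y ∎
      where
      y  = transport (r X) x
      x≡ : x ≡ η (ι X) y
      x≡ = trans (transport-adjoint (r X) refl) (sym (transport-adjoint (r X) (r-η X y)))

-- The bijection for a terminal model.

corollary3p8 :
  ∀ {o q ℓ e p s : Level} (D : DecoratedTheory o q ℓ e p) →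
  let open DecoratedTheory D
      open Exp D using (canonical) in
  (M₀ : Model s Θ₀) (Mᴬ : ModelOver canonical M₀) →
  Category.IsTerminal (ModOver canonical M₀) Mᴬ →
  Σ[ φ ∈ Bijection (setoid (F₀ (model Mᴬ) Exp.A)) (ModOverSetoid inclusion M₀) ]
    ((α : F₀ (model Mᴬ) Exp.A) →
      (∀ X → F₀ (model (Bijection.to φ α)) X ≡ F₀ M₀ X)
      × (∀ {X Y} (f : Theory._⇒_ Θ X Y) →
           Theory._≋_ SetTheory (F₁ (model (Bijection.to φ α)) f) (Exp.slice D (model Mᴬ) α f))
      × (∀ {X Y} (f : Theory._⇒_ Θ₀ X Y) →
           Theory._≋_ SetTheory (F₁ (model (Bijection.to φ α)) (proj₁ f)) (F₁ (model Mᴬ) (Exp.ι₁ f))))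
corollary3p8 D M₀ Mᴬ terminal = record
  { to        = to
  ; cong      = λ { refl → 𝕄.refl }
  ; bijective = injective , λ M →
      -- Terminality provides a morphism from the extension of `M`; the preimage of `M` is where it
      -- sends the one point of `A`.
      let h = proj₁ (terminal (extendOver D M)) in
      ModelOverHom.η h A tt , λ { refl → hom⇒slice D M Mᴬ h }
  } , λ α → eq₀ (over Mᴬ) , (λ f → ≈⇒≋ (λ _ → refl)) , λ f → ≈⇒≋ (slice-pure D (model Mᴬ) α f)
  where
  open DecoratedTheory D
  open Exp D
  open Theory SetTheory using (≈⇒≋)
  module 𝕄 = Setoid (morphismSetoid Θ SetTheory)

  to : F₀ (model Mᴬ) A → ModelOver inclusion M₀
  to = sliceOver D Mᴬ

  -- If the slices agree, `α` and `β` both induce morphisms from the extension of the slice at `α`,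
  -- sending the point of `A` to `α` and to `β`. Terminality makes these morphisms equal.
  injective : ∀ {α β} → model (to α) ≗ model (to β) → α ≡ β
  injective {α} {β} α≗β = trans
    (unique (extendHom D (to α) Mᴬ α 𝕄.refl) A tt)
    (sym (unique (extendHom D (to α) Mᴬ β α≗β) A tt))
    where unique = proj₂ (terminal (extendOver D (to α)))
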